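{- Let $\mathcal{T}$ be the runtime of an optimal algorithm for computing a minimum spanning tree of an edge-weighted, undirected, connected graph. No algorithm can enumerate a minimum spanning tree of an edge-weighted, undirected, connected graph with $n$ vertices with preprocessing in $o(\mathcal{T})$ and delay in $o\!\left(\frac{\mathcal{T}}{n}\right)$.
   Context: Graphs $G=(V,E)$ have vertex set $V=\{1,\dots,n\}$, $m=|E|$ edges and edge weights $w\colon E\to\mathbb{R}$. A spanning tree of $G$ is a connected acyclic subgraph $T=(V,E')$ with $E'\subseteq E$ (so $|E'|=n-1$); a minimum spanning tree (MST) is a spanning tree minimizing $\sum_{e\in E'}w(e)$. "Optimal" means asymptotically optimal worst-case total running time among all MST algorithms in the considered machine model (the statement applies generically to different machine models, e.g. the comparison-based model). Enumeration: given the whole input graph, an enumeration algorithm must, for some single MST $T$ of the graph, emit each edge of $T$ exactly once. Its delay is the worst-case maximum time the algorithm needs to emit the respective next edge; preprocessing time is additional time spent before emitting the first edge. -}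

module Defs where

open import Data.Bool.Base using (if_then_else_)
open import Data.Fin.Base as Fin using (Fin)
open import Data.Fin.Subset using (Subset; _∈_; ⊤)
open import Data.Integer.Base using (+_)
open import Data.List.Base
  using (List; []; _∷_; _++_; [_]; length; catMaybes)
open import Data.List.Membership.Propositional using () renaming (_∈_ to _∈ˡ_)
open import Data.List.Relation.Unary.All using (All)
open import Data.List.Relation.Unary.Linked using (Linked)
open import Data.List.Relation.Unary.Unique.Propositional using (Unique)
open import Data.Maybe.Base using (Maybe; just; nothing)
open import Data.Nat.Base as ℕ using (ℕ; zero; suc; NonZero; _∸_)
open import Data.Product.Base using (Σ; ∃; ∃-syntax; _×_; _,_; proj₁; proj₂)
open import Data.Rational.Base as ℚ
  using (ℚ; 0ℚ; ½; ∣_∣; Positive; _/_)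
import Data.Rational.Properties as ℚ
open import Data.Rational.Solver using (module +-*-Solver)
open import Data.Sum.Base using (_⊎_)
open import Data.Unit.Base using () renaming (⊤ to Unit)
import Data.Vec.Base as Vec
import Data.Vec.Functional as Vector
open import Function.Bundles using (_⇔_)
open import Relation.Binary.Construct.Closure.ReflexiveTransitive using (Star)
open import Relation.Binary.PropositionalEquality
  using (_≡_; refl; sym; trans; cong; cong₂; subst₂)
open import Relation.Nullary.Negation using (¬_)

------------------------------------------------------------------------
-- Real numbers

-- A real number is given by a rational approximation to within ε, for
-- every positive rational ε (a regular Cauchy family).
record ℝ : Set where
  field
    approx  : (ε : ℚ) .{{_ : Positive ε}} → ℚ
    regular : (ε δ : ℚ) .{{_ : Positive ε}} .{{_ : Positive δ}} →
              ∣ approx ε ℚ.- approx δ ∣ ℚ.≤ ε ℚ.+ δ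

open ℝ public

0ℝ : ℝ
0ℝ .approx ε = 0ℚ
0ℝ .regular ε δ =
  ℚ.<⇒≤ (ℚ.positive⁻¹ (ε ℚ.+ δ) {{ℚ.pos+pos⇒pos ε δ}})

private
  half : ℚ → ℚ
  half ε = ½ ℚ.* ε

  half-pos : (ε : ℚ) .{{_ : Positive ε}} → Positive (half ε)
  half-pos ε = ℚ.pos*pos⇒pos ½ ε

  halves : (ε δ : ℚ) →
           (half ε ℚ.+ half δ) ℚ.+ (half ε ℚ.+ half δ) ≡ ε ℚ.+ δ
  halves = solve 2 (λ a b → (con ½ :* a :+ con ½ :* b)
                         :+ (con ½ :* a :+ con ½ :* b) := a :+ b) refl
    where open +-*-Solver

  exchange : (a b c d : ℚ) →
             (a ℚ.- c) ℚ.+ (b ℚ.- d) ≡ (a ℚ.+ b) ℚ.- (c ℚ.+ d)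
  exchange = solve 4 (λ a b c d →
    (a :- c) :+ (b :- d) := (a :+ b) :- (c :+ d)) refl
    where open +-*-Solver

infixl 6 _+ℝ_
infix  4 _≤ℝ_

_+ℝ_ : ℝ → ℝ → ℝ
(x +ℝ y) .approx ε =
  approx x (half ε) {{half-pos ε}} ℚ.+ approx y (half ε) {{half-pos ε}}
(x +ℝ y) .regular ε δ = subst₂ ℚ._≤_
  (cong ∣_∣ (exchange xε yε xδ yδ)) (halves ε δ)
  (ℚ.≤-trans (ℚ.∣p+q∣≤∣p∣+∣q∣ (xε ℚ.- xδ) (yε ℚ.- yδ))
             (ℚ.+-mono-≤
               (regular x (half ε) (half δ) {{half-pos ε}} {{half-pos δ}})
               (regular y (half ε) (half δ) {{half-pos ε}} {{half-pos δ}})))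
  where
  xε = approx x (half ε) {{half-pos ε}}
  yε = approx y (half ε) {{half-pos ε}}
  xδ = approx x (half δ) {{half-pos δ}}
  yδ = approx y (half δ) {{half-pos δ}}

_≤ℝ_ : ℝ → ℝ → Set
x ≤ℝ y = (ε : ℚ) .{{_ : Positive ε}} →
         approx x ε ℚ.≤ approx y ε ℚ.+ (ε ℚ.+ ε)

------------------------------------------------------------------------
-- Weighted graphs and minimum spanning trees

-- A simple undirected graph on the vertices Fin n, whose m edges are
-- named by Fin m.  The edge {u, v} is stored as (u , v) with u < v, so
-- there are no loops, and injectivity of endpoints rules out parallel
-- edges.
record WeightedGraph (n m : ℕ) : Set where
  field
    endpoints : Fin m → Fin n × Fin n
    ordered   : ∀ e → proj₁ (endpoints e) Fin.< proj₂ (endpoints e)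
    distinct  : ∀ e f → endpoints e ≡ endpoints f → e ≡ f
    weight    : Fin m → ℝ

module _ {n m : ℕ} (G : WeightedGraph n m) where
  open WeightedGraph G

  -- A set S of edges stands for the subgraph (V , S).

  Adjacent : Subset m → Fin n → Fin n → Set
  Adjacent S u v =
    ∃[ e ] e ∈ S × (endpoints e ≡ (u , v) ⊎ endpoints e ≡ (v , u))

  ConnectedBy : Subset m → Set
  ConnectedBy S = NonZero n × (∀ u v → Star (Adjacent S) u v)

  Connected : Set
  Connected = ConnectedBy ⊤

  -- The cycle v, vs₁, …, vsₖ, v has length k + 1 ≥ 3.
  IsCycle : Subset m → Fin n → List (Fin n) → Set
  IsCycle S v vs =
    2 ℕ.≤ length vs × Unique (v ∷ vs) × Linked (Adjacent S) (v ∷ vs ++ [ v ])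

  Acyclic : Subset m → Set
  Acyclic S = ∀ v vs → ¬ IsCycle S v vs

  IsSpanningTree : Subset m → Set
  IsSpanningTree S = ConnectedBy S × Acyclic S

  totalWeight : Subset m → ℝ
  totalWeight S =
    Vector.foldr _+ℝ_ 0ℝ (λ e → if Vec.lookup S e then weight e else 0ℝ)

  IsMST : Subset m → Set
  IsMST S = IsSpanningTree S ×
            (∀ S′ → IsSpanningTree S′ → totalWeight S ≤ℝ totalWeight S′)

-- The pairs (n , m) on which worst-case bounds are meaningful.
IsSize : ℕ → ℕ → Set
IsSize n m = ∃[ G ] Connected {n} {m} G

------------------------------------------------------------------------
-- Asymptotics in the size (n , m)

-- For connected simple graphs n ∸ 1 ≤ m ≤ n (n ∸ 1) / 2, so "for large
-- inputs" can be read as "for large n".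

Rate : Set
Rate = (n m : ℕ) .{{_ : NonZero n}} → ℚ

infix 4 _∈O_ _∈o_

_∈O_ : Rate → Rate → Set
f ∈O g = ∃[ C ] ∃[ N ] ∀ n m .{{_ : NonZero n}} → N ℕ.≤ n → IsSize n m →
         f n m ℚ.≤ C ℚ.* g n m

_∈o_ : Rate → Rate → Set
f ∈o g = (ε : ℚ) → .{{_ : Positive ε}} →
         ∃[ N ] ∀ n m .{{_ : NonZero n}} → N ℕ.≤ n → IsSize n m →
         f n m ℚ.≤ ε ℚ.* g n m

Time : Set
Time = ℕ → ℕ → ℕ

rate : Time → Rate
rate f n m = + f n m / 1

ratePerVertex : Time → Rate
ratePerVertex f n m = + f n m / n

------------------------------------------------------------------------
-- Machine models

-- The trace of a computation has one entry per step: the edge emitted in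
-- that step, if any.  The length of a trace is therefore the time taken.
Trace : ℕ → Set
Trace m = List (Maybe (Fin m))

emitted : {m : ℕ} → Trace m → List (Fin m)
emitted = catMaybes

data Run {m : ℕ} {State : Set} (_⟶[_]_ : State → Maybe (Fin m) → State → Set)
       : State → Trace m → State → Set where
  stop : ∀ {s} → Run _⟶[_]_ s [] s
  step : ∀ {s o s′ τ s″} → s ⟶[ o ] s′ → Run _⟶[_]_ s′ τ s″ →
         Run _⟶[_]_ s (o ∷ τ) s″

-- A machine model consists of programs and their deterministic small-step
-- semantics.  Steps form a relation rather than a function because a step
-- may depend on comparisons of real weights, which Agda cannot decide.
--
-- Delays do not constrain what happens after the last edge has been
-- emitted, so the only closure property asked of a model is that a program
-- can be equipped with a counter that halts it once n ∸ 1 edges have been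
-- emitted, at the price of a constant factor in the running time.
record MachineModel : Set₁ where
  field
    Program : Set
    State   : ℕ → ℕ → Set
    start   : ∀ {n m} → Program → WeightedGraph n m → State n m
    _⟶[_]_  : ∀ {n m} → State n m → Maybe (Fin m) → State n m → Set
    deterministic : ∀ {n m} {s s₁ s₂ : State n m} {o₁ o₂} →
                    s ⟶[ o₁ ] s₁ → s ⟶[ o₂ ] s₂ → o₁ ≡ o₂ × s₁ ≡ s₂

  Halted : ∀ {n m} → State n m → Set
  Halted s = ∀ o s′ → ¬ (s ⟶[ o ] s′)

  -- p runs on G with trace τ, possibly without having halted yet.
  RunsWith : ∀ {n m} → Program → WeightedGraph n m → Trace m → Set
  RunsWith p G τ = ∃[ s ] Run _⟶[_]_ (start p G) τ s

  HaltsWith : ∀ {n m} → Program → WeightedGraph n m → Trace m → Set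
  HaltsWith p G τ = ∃[ s ] Run _⟶[_]_ (start p G) τ s × Halted s

  field
    stopAfterTree : (p : Program) → ∃[ q ] ∃[ c ]
      ∀ {n m} (G : WeightedGraph n m) (τ : Trace m) →
      RunsWith p G τ → length (emitted τ) ≡ n ∸ 1 →
      ∃[ τ′ ] HaltsWith q G τ′ × emitted τ′ ≡ emitted τ ×
              length τ′ ℕ.≤ c ℕ.* suc (length τ)

------------------------------------------------------------------------
-- Algorithms

Lists : {m : ℕ} → List (Fin m) → Subset m → Set
Lists es S = ∀ e → (e ∈ˡ es) ⇔ (e ∈ S)

-- waits k τ: the time until the first emission and then between
-- consecutive emissions, where k steps have already been spent.
waits : {m : ℕ} → ℕ → Trace m → List ℕ
waits k []            = []
waits k (nothing ∷ τ) = waits (suc k) τ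
waits k (just _  ∷ τ) = suc k ∷ waits 0 τ

-- The preprocessing time is spent in addition to the first delay.
WaitsWithin : (preprocessing delay : ℕ) → List ℕ → Set
WaitsWithin pre del []       = Unit
WaitsWithin pre del (w ∷ ws) = w ℕ.≤ pre ℕ.+ del × All (ℕ._≤ del) ws

module _ (M : MachineModel) where
  open MachineModel M

  ComputesMST : Program → Set
  ComputesMST p = ∀ {n m} (G : WeightedGraph n m) → Connected G →
    ∃[ τ ] HaltsWith p G τ × (∃[ S ] IsMST G S × Lists (emitted τ) S)

  -- By determinism there is at most one τ with HaltsWith p G τ.
  RunsInTimeAt : Program → (n m : ℕ) → ℕ → Set
  RunsInTimeAt p n m t = (G : WeightedGraph n m) → Connected G →
    ∀ τ → HaltsWith p G τ → length τ ℕ.≤ t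

  RunsInTime : Program → Time → Set
  RunsInTime p f = ∀ n m → RunsInTimeAt p n m (f n m)

  -- f is the exact worst-case running time (on sizes that occur).
  IsRunningTime : Program → Time → Set
  IsRunningTime p f = RunsInTime p f ×
    (∀ n m → IsSize n m → ∀ t → RunsInTimeAt p n m t → f n m ℕ.≤ t)

  IsOptimalMSTTime : Time → Set
  IsOptimalMSTTime T =
    (∃[ p ] ComputesMST p × IsRunningTime p T) ×
    (∀ q f → ComputesMST q → RunsInTime q f → rate T ∈O rate f)

  EnumeratesMST : Program → (preprocessing delay : Time) → Set
  EnumeratesMST p pre del =
    ∀ {n m} (G : WeightedGraph n m) → Connected G →
    ∃[ τ ] HaltsWith p G τ ×
      (∃[ S ] IsMST G S × Lists (emitted τ) S × Unique (emitted τ)) ×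
      WaitsWithin (pre n m) (del n m) (waits 0 τ)

{-# OPTIONS --safe #-}
module Submission where

-- A spanning tree has n − 1 edges, so stopping an enumeration after its
-- (n − 1)-st emission yields an MST algorithm with running time
-- O(1 + pre + (n − 1) del).  If pre = o(T) and del = o(T / n) this is o(T), as
-- T ≥ n − 1 (every tree edge takes a step to emit) absorbs the constant; that
-- contradicts optimality.  The asymptotic bounds are compared on stars, which
-- provide a connected graph for every n.

open import Data.Empty using (⊥-elim)
open import Data.Fin.Base as Fin using (Fin; zero; suc; punchIn; punchOut)
open import Data.Fin.Properties
  using (_≟_; punchInᵢ≢i; punchOut-punchIn; punchOut-cong; punchOut-injective)
open import Data.Fin.Subset using (Subset; _∈_; ⊤)
open import Data.Fin.Subset.Properties using (∈⊤)
open import Data.Integer.Base as ℤ using (+_; -[1+_]; +≤+; -≤+)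
import Data.Integer.Properties as ℤ
open import Data.List.Base using (List; []; _∷_; _++_; [_]; length)
open import Data.List.Membership.Propositional using () renaming (_∈_ to _∈ˡ_; _∉_ to _∉ˡ_)
open import Data.List.Membership.DecPropositional using (_∈?_)
open import Data.List.Properties using (length-catMaybes)
open import Data.List.Relation.Unary.All using (All; []; _∷_)
import Data.List.Relation.Unary.All as All
open import Data.List.Relation.Unary.All.Properties using (All¬⇒¬Any; ¬Any⇒All¬)
open import Data.List.Relation.Unary.AllPairs using ([]; _∷_)
open import Data.List.Relation.Unary.Any using (here; there)
open import Data.List.Relation.Unary.Linked using (Linked; [-]; _∷_)
open import Data.List.Relation.Unary.Unique.Propositional using (Unique)
open import Data.Maybe.Base using (Maybe; just; nothing)
open import Data.Nat.Base using
  (ℕ; zero; suc; NonZero; _+_; _*_; _∸_; _≤_; z≤n; s≤s; _⊔_;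
  >-nonZero; >-nonZero⁻¹)
open import Data.Nat.ListAction using (sum)
import Data.Nat.Properties as ℕ
open import Data.Nat.Tactic.RingSolver using (solve-∀)
open import Data.Product.Base using (∃-syntax; _×_; _,_; proj₁; proj₂)
open import Data.Rational.Base as ℚ using (mkℚ; _/_; toℚᵘ)
import Data.Rational.Properties as ℚ
open import Data.Rational.Unnormalised.Base as ℚᵘ using (mkℚᵘ)
import Data.Rational.Unnormalised.Properties as ℚᵘ
open import Data.Sum.Base using (_⊎_; inj₁; inj₂)
open import Function.Base using (_∘_)
open import Function.Bundles using (Equivalence)
open import Level using (0ℓ)
open import Relation.Binary.Construct.Closure.ReflexiveTransitive as Star
  using (Star; ε; _◅_; _◅◅_)
open import Relation.Binary.Core using (Rel)
open import Relation.Binary.PropositionalEquality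
  using (_≡_; _≢_; refl; sym; trans; cong; subst; subst₂)
open import Relation.Nullary.Decidable using (yes; no)
open import Relation.Nullary.Negation using (¬_; contradiction)
open import Defs

-- Paths

-- The list omits the starting point, so that `a ∷ xs` is the vertex sequence in the form in which
-- `IsCycle` takes it.
data Path {A : Set} (R : Rel A 0ℓ) : A → List A → A → Set where
  []  : ∀ {a} → Path R a [] a
  _∷_ : ∀ {a x b xs} → R a x → Path R x xs b → Path R a (x ∷ xs) b

module _ {A : Set} {R : Rel A 0ℓ} where

  suffixFrom : ∀ {a b x xs} → Path R a xs b → Unique (a ∷ xs) → x ∈ˡ a ∷ xs →
               ∃[ ys ] Path R x ys b × Unique (x ∷ ys)
  suffixFrom p       u       (here refl) = _ , p , u
  suffixFrom (_ ∷ p) (_ ∷ u) (there x∈)  = suffixFrom p u x∈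

  close : ∀ {T : Rel A 0ℓ} → (∀ {x y} → R x y → T x y) →
          ∀ {a b z xs} → Path R a xs b → T b z → Linked T (a ∷ xs ++ [ z ])
  close f []      t = t ∷ [-]
  close f (r ∷ p) t = f r ∷ close f p t

-- Loop erasure from the far end: if the new first vertex already lies on the simple path behind it,
-- only the part of that path from this vertex on is kept.
simplePath : ∀ {n} {R : Rel (Fin n) 0ℓ} {a b} → Star R a b →
             ∃[ xs ] Path R a xs b × Unique (a ∷ xs)
simplePath ε = [] , [] , [] ∷ []
simplePath {a = a} (_◅_ {j = x} r s) with simplePath s
... | xs , p , u with _∈?_ _≟_ a (x ∷ xs)
...   | yes a∈ = suffixFrom p u a∈
...   | no a∉  = x ∷ xs , r ∷ p , ¬Any⇒All¬ _ a∉ ∷ u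

-- Identifying two elements of a finite set

-- The image of `i` is that of `j`, and `punchOut` closes the gap that `i` leaves.
merge : ∀ {k} {i j : Fin (suc k)} → i ≢ j → Fin (suc k) → Fin k
merge {i = i} i≢j x with i ≟ x
... | yes _   = punchOut i≢j
... | no i≢x = punchOut i≢x

module _ {k} {i j : Fin (suc k)} (i≢j : i ≢ j) where

  merge-punchIn : ∀ y → merge i≢j (punchIn i y) ≡ y
  merge-punchIn y with i ≟ punchIn i y
  ... | yes eq = contradiction (sym eq) (punchInᵢ≢i i y)
  ... | no ne  = trans (punchOut-cong i refl) (punchOut-punchIn i)

  merge-identifies : merge i≢j i ≡ merge i≢j j
  merge-identifies with i ≟ i | i ≟ j
  ... | no ne | _       = contradiction refl ne
  ... | _     | yes eq  = contradiction eq i≢j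
  ... | yes _ | no i≢j′ = punchOut-cong i refl

  merge-kernel : ∀ x y → merge i≢j x ≡ merge i≢j y →
                 x ≡ y ⊎ (x ≡ i × y ≡ j) ⊎ (x ≡ j × y ≡ i)
  merge-kernel x y eq with i ≟ x | i ≟ y
  ... | yes p | yes q = inj₁ (trans (sym p) q)
  ... | yes p | no q  = inj₂ (inj₁ (sym p , sym (punchOut-injective i≢j q eq)))
  ... | no p  | yes q = inj₂ (inj₂ (punchOut-injective p i≢j eq , sym q))
  ... | no p  | no q  = inj₁ (punchOut-injective p q eq)

-- Spanning trees

module _ {n m : ℕ} (G : WeightedGraph n m) where
  open WeightedGraph G

  private
    src tgt : Fin m → Fin n
    src = proj₁ ∘ endpoints
    tgt = proj₂ ∘ endpoints

  Joined : List (Fin m) → Fin n → Fin n → Set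
  Joined es u v = ∃[ e ] e ∈ˡ es × (endpoints e ≡ (u , v) ⊎ endpoints e ≡ (v , u))

  Joined-there : ∀ {es e u v} → Joined es u v → Joined (e ∷ es) u v
  Joined-there (f , f∈ , j) = f , there f∈ , j

  -- A simple path in `es` between the ends of `e` is closed up by `e` itself. The cycle has length
  -- at least 3, as the graph has neither loops nor parallel edges and `e` is not in `es`.
  cycleThrough : ∀ {S es e} → e ∈ S → All (_∈ S) es → e ∉ˡ es →
                 Star (Joined es) (src e) (tgt e) → ∃[ vs ] IsCycle G S (src e) vs
  cycleThrough {S} {es} {e} e∈S es⊆S e∉es s with simplePath s
  ... | vs , p , u =
    vs , long p , u , close (λ (f , f∈ , j) → f , All.lookup es⊆S f∈ , j) p
                            (e , e∈S , inj₂ refl)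
    where
    long : ∀ {vs} → Path (Joined es) (src e) vs (tgt e) → 2 ≤ length vs
    long p = go p refl
      where
      go : ∀ {b vs} → Path (Joined es) (src e) vs b → b ≡ tgt e → 2 ≤ length vs
      go [] eq = contradiction (ordered e) (ℕ.<-irrefl (cong Fin.toℕ eq))
      -- A single edge with the endpoints of `e` in the same order would be `e`; in the reverse
      -- order it would violate `ordered`.
      go ((f , f∈ , inj₁ eq) ∷ []) refl =
        contradiction (subst (_∈ˡ es) (distinct f e eq) f∈) e∉es
      go ((f , f∈ , inj₂ eq) ∷ []) refl =
        contradiction (subst (λ (x , y) → x Fin.< y) eq (ordered f))
                      (ℕ.<-asym (ordered e))
      go (_ ∷ _ ∷ _) _ = s≤s (s≤s z≤n)

  -- Labels name the connected components of (V , `es`); since every label occurs, `k` is exactly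
  -- their number.
  record Components (es : List (Fin m)) (k : ℕ) : Set where
    field
      label      : Fin n → Fin k
      surjective : ∀ i → ∃[ v ] label v ≡ i
      sound      : ∀ u v → label u ≡ label v → Star (Joined es) u v
      complete   : ∀ {u v} → Joined es u v → label u ≡ label v

  -- Acyclicity is expressed through a superset `S`, so that it passes to the tail of the list with
  -- the same `S`.
  IsForest : List (Fin m) → Set
  IsForest es = Unique es × ∃[ S ] Acyclic G S × All (_∈ S) es

  -- Adding an edge merges two components, unless it closes a cycle.
  components : ∀ es → ∃[ k ] Components es k × n ≤ k + length es ×
                                 (IsForest es → k + length es ≡ n)
  components [] = n , C , ℕ.m≤m+n n 0 , λ _ → ℕ.+-identityʳ n
    where
    C : Components [] n
    C .Components.label v = v
    C .Components.surjective i = i , refl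
    C .Components.sound u v refl = ε
    C .Components.complete (_ , () , _)
  components (e ∷ es) with components es
  ... | zero , C , _ with Components.label C (src e)
  ...   | ()
  components (e ∷ es) | suc k , C , n≤ , forest
    with Components.label C (src e) ≟ Components.label C (tgt e)
  -- The number of components stays while the list grows, so the inequality only gets weaker; in a
  -- forest, `e` would close a cycle.
  ... | yes i≡j = suc k , C′ , ℕ.≤-trans n≤ (ℕ.+-monoʳ-≤ (suc k) (ℕ.n≤1+n _)) ,
      λ { (e# ∷ u , S , acyclic , e∈S ∷ es⊆S) →
        let vs , cyc = cycleThrough e∈S es⊆S (All¬⇒¬Any e#) (C.sound _ _ i≡j)
        in ⊥-elim (acyclic _ vs cyc) }
      where
      module C = Components C
      C′ : Components (e ∷ es) (suc k)
      C′ .Components.label = C.label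
      C′ .Components.surjective = C.surjective
      C′ .Components.sound u v eq = Star.map Joined-there (C.sound u v eq)
      C′ .Components.complete (_ , here refl , inj₁ refl) = i≡j
      C′ .Components.complete (_ , here refl , inj₂ refl) = sym i≡j
      C′ .Components.complete (f , there f∈ , j) = C.complete (f , f∈ , j)
  -- One component fewer and one edge more: the sum in both bounds is unchanged.
  components (e ∷ es) | suc k , C , n≤ , forest | no i≢j =
      k , C′ , subst (n ≤_) (sym (ℕ.+-suc k _)) n≤ ,
      λ { (_ ∷ u , S , acyclic , _ ∷ es⊆S) →
        trans (ℕ.+-suc k _) (forest (u , S , acyclic , es⊆S)) }
      where
      module C = Components C
      old : ∀ u v → C.label u ≡ C.label v → Star (Joined (e ∷ es)) u v
      old u v eq = Star.map Joined-there (C.sound u v eq)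

      C′ : Components (e ∷ es) k
      C′ .Components.label v = merge i≢j (C.label v)
      C′ .Components.surjective y =
        let v , eq = C.surjective (punchIn (C.label (src e)) y)
        in v , trans (cong (merge i≢j) eq) (merge-punchIn i≢j y)
      -- Either the old labels agree, or `u` and `v` lie in the two merged components and the walk
      -- crosses `e` in one of its directions.
      C′ .Components.sound u v eq with merge-kernel i≢j _ _ eq
      ... | inj₁ same = old u v same
      ... | inj₂ (inj₁ (ui , vj)) =
        old u (src e) ui ◅◅ (e , here refl , inj₁ refl) ◅ old (tgt e) v (sym vj)
      ... | inj₂ (inj₂ (uj , vi)) =
        old u (tgt e) uj ◅◅ (e , here refl , inj₂ refl) ◅ old (src e) v (sym vi)
      C′ .Components.complete (_ , here refl , inj₁ refl) = merge-identifies i≢j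
      C′ .Components.complete (_ , here refl , inj₂ refl) = sym (merge-identifies i≢j)
      C′ .Components.complete (f , there f∈ , j) = cong (merge i≢j) (C.complete (f , f∈ , j))

  -- Labels are constant along walks, so connectedness leaves only one; a vertex exists, which
  -- excludes `k` being zero.
  connected⇒one-component : ∀ {es S k} → Lists es S → ConnectedBy G S →
                            Components es k → k ≡ 1
  connected⇒one-component {es} {S} {k} lists (n≢0 , conn) C = one k C n≢0
    where
    same : ∀ {k} (C : Components es k) u v → Components.label C u ≡ Components.label C v
    same C u v = Star.fold (λ u v → label u ≡ label v)
      (λ (e , e∈ , j) eq → trans (complete (e , Equivalence.from (lists e) e∈ , j)) eq)
      refl (conn u v)
      where open Components C
    one : ∀ k → Components es k → NonZero n → k ≡ 1
    one zero C n≢0 with Components.label C (Fin.fromℕ< (>-nonZero⁻¹ n {{n≢0}}))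
    ... | ()
    one (suc zero) C _ = refl
    one (suc (suc k)) C _ with Components.surjective C zero | Components.surjective C (suc zero)
    ... | u , eu | v , ev with trans (sym eu) (trans (same C u v) ev)
    ...   | ()

  -- An MST algorithm may emit an edge repeatedly, hence only an inequality here.
  connected⇒length≥ : ∀ {es S} → Lists es S → ConnectedBy G S → n ∸ 1 ≤ length es
  connected⇒length≥ {es} lists conn with components es
  ... | k , C , n≤ , _ with connected⇒one-component lists conn C
  ...   | refl = ℕ.∸-monoˡ-≤ 1 n≤

  -- The exact count is what `stopAfterTree` asks for.
  tree⇒length≡ : ∀ {es S} → Lists es S → Unique es → IsSpanningTree G S →
                 length es ≡ n ∸ 1
  tree⇒length≡ {es} {S} lists unique (conn , acyclic) with components es
  ... | k , C , _ , forest with connected⇒one-component lists conn C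
  ...   | refl = cong (_∸ 1)
    (forest (unique , S , acyclic , All.tabulate (λ {e} → Equivalence.to (lists e))))

-- Stars

star : ∀ n → WeightedGraph (suc n) n
star n .WeightedGraph.endpoints e = zero , suc e
star n .WeightedGraph.ordered e = s≤s z≤n
star n .WeightedGraph.distinct e f refl = refl
star n .WeightedGraph.weight _ = 0ℝ

star-connected : ∀ n → Connected (star n)
star-connected n = _ , λ u v → toCentre u ◅◅ fromCentre v
  where
  fromCentre : ∀ v → Star (Adjacent (star n) ⊤) zero v
  fromCentre zero    = ε
  fromCentre (suc e) = (e , ∈⊤ , inj₁ refl) ◅ ε
  toCentre : ∀ v → Star (Adjacent (star n) ⊤) v zero
  toCentre zero    = ε
  toCentre (suc e) = (e , ∈⊤ , inj₂ refl) ◅ ε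

-- Traces

length-waits : ∀ {m} k (τ : Trace m) → length (waits k τ) ≡ length (emitted τ)
length-waits k []            = refl
length-waits k (nothing ∷ τ) = length-waits (suc k) τ
length-waits k (just _  ∷ τ) = cong suc (length-waits 0 τ)

sum≤length* : ∀ {d} {ws} → All (_≤ d) ws → sum ws ≤ length ws * d
sum≤length* []         = z≤n
sum≤length* (w≤d ∷ ps) = ℕ.+-mono-≤ w≤d (sum≤length* ps)

sum-waits≤ : ∀ {p d} ws → WaitsWithin p d ws → sum ws ≤ p + length ws * d
sum-waits≤ []       _         = z≤n
sum-waits≤ {p} {d} (w ∷ ws) (w≤ , ps) = subst (w + sum ws ≤_) (ℕ.+-assoc p d _)
  (ℕ.+-mono-≤ w≤ (sum≤length* ps))

module _ {m : ℕ} {State : Set} {_⟶[_]_ : State → Maybe (Fin m) → State → Set} where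

  -- The run is cut after its last emission, because later steps enter no wait. As in `waits`, `k`
  -- counts steps already spent. A run without emissions is a separate case: its waits sum to zero,
  -- which does not cover a positive `k`.
  truncate : ∀ k {s τ s″} → Run _⟶[_]_ s τ s″ →
    emitted τ ≡ [] ⊎
    ∃[ τ′ ] ∃[ s′ ] Run _⟶[_]_ s τ′ s′ × emitted τ′ ≡ emitted τ ×
                    k + length τ′ ≤ sum (waits k τ)
  truncate k stop = inj₁ refl
  truncate k (step {o = nothing} {τ = τ} t r) with truncate (suc k) r
  ... | inj₁ none = inj₁ none
  ... | inj₂ (τ′ , s′ , r′ , eq , le) =
    inj₂ (nothing ∷ τ′ , s′ , step t r′ , eq ,
          subst (_≤ sum (waits (suc k) τ)) (sym (ℕ.+-suc k _)) le)
  truncate k (step {o = just e} {τ = τ} t r) with truncate 0 r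
  ... | inj₁ none =
    inj₂ (just e ∷ [] , _ , step t stop , cong (e ∷_) (sym none) ,
          subst (_≤ suc k + sum (waits 0 τ)) (sym (ℕ.+-comm k 1)) (ℕ.m≤m+n (suc k) _))
  ... | inj₂ (τ′ , s′ , r′ , eq , le) =
    inj₂ (just e ∷ τ′ , s′ , step t r′ , cong (e ∷_) eq ,
          subst (_≤ suc k + sum (waits 0 τ)) (sym (ℕ.+-suc k _)) (ℕ.+-monoʳ-≤ (suc k) le))

  untilLastEmission : ∀ {s τ s″} → Run _⟶[_]_ s τ s″ →
    ∃[ τ′ ] ∃[ s′ ] Run _⟶[_]_ s τ′ s′ × emitted τ′ ≡ emitted τ ×
                    length τ′ ≤ sum (waits 0 τ)
  untilLastEmission r with truncate 0 r
  -- For `k` zero the empty run covers this case, which arises for graphs with one vertex.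
  ... | inj₁ none  = [] , _ , stop , sym none , z≤n
  ... | inj₂ found = found

-- From enumeration to computation

enumerationTime : (c : ℕ) (pre del : Time) → Time
enumerationTime c pre del n m = c * suc (pre n m + (n ∸ 1) * del n m)

module _ (M : MachineModel) where
  open MachineModel M

  -- `RunsInTimeAt` bounds every halting trace; this transfers a bound known for one of them.
  halting-trace-unique : ∀ {n m} {s s₁ s₂ : State n m} {τ₁ τ₂} →
    Run _⟶[_]_ s τ₁ s₁ → Halted s₁ → Run _⟶[_]_ s τ₂ s₂ → Halted s₂ → τ₁ ≡ τ₂
  halting-trace-unique stop        h₁ stop        h₂ = refl
  halting-trace-unique stop        h₁ (step t _)  h₂ = contradiction t (h₁ _ _)
  halting-trace-unique (step t _)  h₁ stop        h₂ = contradiction t (h₂ _ _)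
  halting-trace-unique (step t r₁) h₁ (step u r₂) h₂ with deterministic t u
  ... | refl , refl = cong (_ ∷_) (halting-trace-unique r₁ h₁ r₂ h₂)

  ComputesMST⇒time≥ : ∀ {p f n m} → ComputesMST M p → RunsInTime M p f →
                      IsSize n m → n ∸ 1 ≤ f n m
  ComputesMST⇒time≥ {f = f} {n} {m} computes time (G , conn) with computes G conn
  ... | τ , halts , S , ((connS , _) , _) , lists = begin
    n ∸ 1              ≤⟨ connected⇒length≥ G lists connS ⟩
    length (emitted τ) ≤⟨ length-catMaybes τ ⟩
    length τ           ≤⟨ time n m G conn τ halts ⟩
    f n m              ∎
    where open ℕ.≤-Reasoning

  -- `stopAfterTree` is applied to the run cut at its last emission, whose length the waits control;
  -- the factor `c` and the `suc` in the time bound are its price.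
  enumeration⇒computation : ∀ {p pre del} → EnumeratesMST M p pre del →
    ∃[ q ] ∃[ c ] ComputesMST M q ×
      RunsInTime M q (enumerationTime c pre del)
  enumeration⇒computation {p} {pre} {del} enumerates with stopAfterTree p
  ... | q , c , stopped =
    q , c , (λ G conn → let τ , h , mst , _ = halting G conn in τ , h , mst) , time
    where
    halting : ∀ {n m} (G : WeightedGraph n m) → Connected G →
      ∃[ τ ] HaltsWith q G τ × (∃[ S ] IsMST G S × Lists (emitted τ) S) ×
             length τ ≤ enumerationTime c pre del n m
    halting {n} {m} G conn with enumerates G conn
    ... | τ , (_ , run , _) , (S , mst , lists , unique) , within
      with untilLastEmission run
    ...   | τ₁ , s₁ , run₁ , eq₁ , le₁
      with tree⇒length≡ G lists unique (proj₁ mst)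
    ...     | len with stopped G τ₁ (s₁ , run₁) (trans (cong length eq₁) len)
    ...       | τ₂ , halts , eq₂ , le₂ =
      τ₂ , halts , (S , mst , subst (λ es → Lists es S) (sym (trans eq₂ eq₁)) lists) ,
      ℕ.≤-trans le₂ (ℕ.*-monoʳ-≤ c (s≤s (begin
        length τ₁                                          ≤⟨ le₁ ⟩
        sum (waits 0 τ)                                    ≤⟨ sum-waits≤ (waits 0 τ) within ⟩
        pre n m + length (waits 0 τ) * del n m             ≡⟨ cong (λ l → pre n m + l * del n m)
                                                                (trans (length-waits 0 τ) len) ⟩
        pre n m + (n ∸ 1) * del n m                        ∎)))
      where open ℕ.≤-Reasoning
    time : RunsInTime M q (enumerationTime c pre del)
    time n m G conn τ (_ , run , h) with halting G conn
    ... | _ , (_ , run′ , h′) , _ , le with halting-trace-unique run h run′ h′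
    ...   | refl = le

-- From rational to natural bounds

-- Cross-multiplication. It is done on unnormalised rationals, where numerators and denominators are
-- not reduced.
/-≤⇒*-≤ : ∀ a x b y z .{{_ : NonZero y}} .{{_ : NonZero z}} →
          + a / 1 ℚ.≤ (+ x / y) ℚ.* (+ b / z) → a * (y * z) ≤ x * b
/-≤⇒*-≤ a x b (suc y) (suc z) le = ℤ.drop‿+≤+ (subst₂ ℤ._≤_
    (sym (ℤ.pos-* a _)) (trans (ℤ.*-identityʳ _) (sym (ℤ.pos-* x b))) (ℚᵘ.drop-*≤* le′))
  where
  le′ : mkℚᵘ (+ a) 0 ℚᵘ.≤ mkℚᵘ (+ x) y ℚᵘ.* mkℚᵘ (+ b) z
  le′ = begin
    mkℚᵘ (+ a) 0                                   ≃⟨ ℚ.toℚᵘ-fromℚᵘ (mkℚᵘ (+ a) 0) ⟨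
    toℚᵘ (+ a / 1)                                 ≤⟨ ℚ.toℚᵘ-mono-≤ le ⟩
    toℚᵘ ((+ x / suc y) ℚ.* (+ b / suc z))         ≃⟨ ℚ.toℚᵘ-homo-* (+ x / suc y) (+ b / suc z) ⟩
    toℚᵘ (+ x / suc y) ℚᵘ.* toℚᵘ (+ b / suc z)     ≃⟨ ℚᵘ.*-cong (ℚ.toℚᵘ-fromℚᵘ (mkℚᵘ (+ x) y))
                                                                 (ℚ.toℚᵘ-fromℚᵘ (mkℚᵘ (+ b) z)) ⟩
    mkℚᵘ (+ x) y ℚᵘ.* mkℚᵘ (+ b) z                 ∎
    where open ℚᵘ.≤-Reasoning

≤-natural : ∀ C → ∃[ K ] C ℚ.≤ + K / 1
-- Denominators are at least 1, so the absolute value of the numerator is large enough.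
≤-natural C@(mkℚ i d _) = ℤ.∣ i ∣ , ℚ.toℚᵘ-cancel-≤
  (ℚᵘ.≤-respʳ-≃ (ℚᵘ.≃-sym (ℚ.toℚᵘ-fromℚᵘ (mkℚᵘ (+ ℤ.∣ i ∣) 0))) (ℚᵘ.*≤* (bound i)))
  where
  bound : ∀ i → i ℤ.* + 1 ℤ.≤ + ℤ.∣ i ∣ ℤ.* + suc d
  bound (+ k)    = subst₂ ℤ._≤_ (ℤ.pos-* k 1) (ℤ.pos-* k (suc d))
    (+≤+ (ℕ.*-monoʳ-≤ k (s≤s z≤n)))
  bound -[1+ k ] = -≤+

∈O⇒≤ : ∀ (f g : Time) → rate f ∈O rate g →
       ∃[ K ] ∃[ N ] ∀ n m → .{{_ : NonZero n}} → N ≤ n → IsSize n m →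
       f n m ≤ K * g n m
∈O⇒≤ f g (C , N , bound) with ≤-natural C
... | K , C≤K = K , N , λ n m N≤n size →
  subst (_≤ K * g n m) (ℕ.*-identityʳ (f n m))
    (/-≤⇒*-≤ (f n m) K (g n m) 1 1
      (ℚ.≤-trans (bound n m N≤n size)
        (ℚ.*-monoʳ-≤-nonNeg (+ g n m / 1) {{ℚ.normalize-nonNeg (g n m) 1}} C≤K)))

-- The definition is used with ε = 1 / (1 + `D`), and the denominators are cleared.
∈o⇒≤ : ∀ (f g : Time) → rate f ∈o rate g → ∀ D →
       ∃[ N ] ∀ n m → .{{_ : NonZero n}} → N ≤ n → IsSize n m →
       f n m * suc D ≤ g n m
∈o⇒≤ f g little D with little (+ 1 / suc D) {{ℚ.normalize-pos 1 (suc D)}}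
... | N , bound = N , λ n m N≤n size →
  subst₂ _≤_ (cong (f n m *_) (ℕ.*-identityʳ (suc D))) (ℕ.*-identityˡ _)
    (/-≤⇒*-≤ (f n m) 1 (g n m) (suc D) 1 (bound n m N≤n size))

∈o-perVertex⇒≤ : ∀ (f g : Time) → rate f ∈o ratePerVertex g → ∀ D →
       ∃[ N ] ∀ n m → .{{_ : NonZero n}} → N ≤ n → IsSize n m →
       f n m * (suc D * n) ≤ g n m
∈o-perVertex⇒≤ f g little D with little (+ 1 / suc D) {{ℚ.normalize-pos 1 (suc D)}}
... | N , bound = N , λ n m N≤n size →
  subst (f n m * (suc D * n) ≤_) (ℕ.*-identityˡ _)
    (/-≤⇒*-≤ (f n m) 1 (g n m) (suc D) n (bound n m N≤n size))

-- Multiplying T ≤ A (1 + P + k d) by D bounds each of the three summands by T,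
-- whence D T ≤ 3 A T; the constant D = 3 A + 1 is chosen to exclude this.
no-self-improvement : ∀ A {T P d k} → let D = suc (3 * A) in
  D ≤ T → P * D ≤ T → d * (D * suc k) ≤ T → ¬ (T ≤ A * suc (P + k * d))
no-self-improvement A {T} {P} {d} {k} D≤T P≤T d≤T T≤ =
  ℕ.1+n≰n (ℕ.*-cancelʳ-≤ D (3 * A) T {{T≢0}} (begin
  D * T                                       ≡⟨ ℕ.*-comm D T ⟩
  T * D                                       ≤⟨ ℕ.*-monoˡ-≤ D T≤ ⟩
  A * suc (P + k * d) * D                     ≡⟨ expand A P k d D ⟩
  -- The delay is bounded relative to 1 + `k` vertices but occurs only `k` times.
  A * (D + (P * D + d * (D * k)))             ≤⟨ ℕ.*-monoʳ-≤ A (ℕ.+-mono-≤ D≤T (ℕ.+-mono-≤ P≤T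
                                                   (ℕ.≤-trans (ℕ.*-monoʳ-≤ d (ℕ.*-monoʳ-≤ D (ℕ.n≤1+n k))) d≤T))) ⟩
  A * (T + (T + T))                           ≡⟨ triple A T ⟩
  3 * A * T                                   ∎))
  where
  open ℕ.≤-Reasoning
  D = suc (3 * A)
  T≢0 : NonZero T
  T≢0 = >-nonZero (ℕ.≤-trans (s≤s z≤n) D≤T)
  expand : ∀ A P k d D → A * suc (P + k * d) * D ≡ A * (D + (P * D + d * (D * k)))
  expand = solve-∀
  triple : ∀ A T → A * (T + (T + T)) ≡ 3 * A * T
  triple = solve-∀

-- Contradiction with optimality

corollary4 : (M : MachineModel) (T : Time) → IsOptimalMSTTime M T →
    ¬ (∃[ p ] ∃[ pre ] ∃[ del ] EnumeratesMST M p pre del ×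
    rate pre ∈o rate T × rate del ∈o ratePerVertex T)
corollary4 M T ((_ , computes , runs , _) , optimal) (p , pre , del , enum , pre∈o , del∈o)
  with enumeration⇒computation M enum
... | q , c , computes′ , runs′
  with ∈O⇒≤ T (enumerationTime c pre del) (optimal q _ computes′ runs′)
... | K , N₁ , T≤
  -- Optimality loses the factor `K` and stopping the factor `c`, so `no-self-improvement` applies
  -- with `A` equal to `K * c`.
  with ∈o⇒≤ pre T pre∈o (3 * (K * c)) | ∈o-perVertex⇒≤ del T del∈o (3 * (K * c))
... | N₂ , pre≤ | N₃ , del≤ =
  no-self-improvement (K * c) {P = pre (suc k) k} {d = del (suc k) k} {k}
    (ℕ.≤-trans (ℕ.m≤m+n D N) (ComputesMST⇒time≥ M computes runs size))
    (pre≤ (suc k) k (below (ℕ.≤-trans (ℕ.m≤n⊔m N₁ N₂) (ℕ.m≤m⊔n _ N₃))) size)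
    (del≤ (suc k) k (below (ℕ.m≤n⊔m _ N₃)) size)
    (subst (T (suc k) k ≤_) (sym (ℕ.*-assoc K c _))
      (T≤ (suc k) k (below (ℕ.≤-trans (ℕ.m≤m⊔n N₁ N₂) (ℕ.m≤m⊔n _ N₃))) size))
  where
  D N k : ℕ
  D = suc (3 * (K * c))
  N = N₁ ⊔ N₂ ⊔ N₃
  -- The summand `N` takes the star beyond all three thresholds; the summand `D` gives `D` ≤ `k` ≤
  -- `T (suc k) k`, as a tree on 1 + `k` vertices has `k` edges.
  k = D + N
  size : IsSize (suc k) k
  size = star k , star-connected k
  below : ∀ {x} → x ≤ N → x ≤ suc k
  below x≤N = ℕ.≤-trans x≤N (ℕ.m≤n⇒m≤1+n (ℕ.m≤n+m N D))
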